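{- Let $\Gamma=\Gamma_{D^- }$ be the coset graph of the additive code $D^-$ defined in the context, and let $\Gamma_2$ be the graph on the same vertex set in which two vertices are adjacent iff they are at distance $2$ in $\Gamma$. Then $\Gamma_2$ is strongly regular with parameters $(2^{10},495,238,240)$.
   Context: $\mathbb{F}_4=\{0,1,\omega,\omega^2\}$ with $\omega^2=\omega+1$. The coset graph $\Gamma_C$ of an additive code $C\subseteq\mathbb{F}_4^n$ (additive subgroup) has as vertices the cosets $x+C$, two cosets adjacent if their difference contains a vector of Hamming weight $1$. Strongly regular parameters $(\nu,\kappa,\lambda,\mu)$: number of vertices, degree, common neighbours of adjacent pairs, common neighbours of non-adjacent pairs. $D^-$ is the $\mathbb{F}_2$-span of the following $12$ vectors of $\mathbb{F}_4^{11}$: $(0,0,0,0,0,\omega^2,\omega^2,0,\omega,1,\omega)$, $(0,0,0,0,0,\omega,0,\omega,\omega,\omega,1)$, $(1,0,0,0,0,1,0,1,\omega^2,\omega^2,1)$, $(\omega,0,0,0,0,0,\omega,1,\omega,\omega,\omega)$, $(0,1,0,0,0,0,1,1,1,\omega^2,\omega^2)$, $(0,\omega,0,0,0,\omega^2,1,\omega^2,\omega,\omega,0)$, $(0,0,1,0,0,\omega,\omega,1,1,0,1)$, $(0,0,\omega,0,0,\omega,1,\omega,\omega^2,\omega^2,0)$, $(0,0,0,1,0,\omega,\omega,\omega,0,1,\omega)$, $(0,0,0,\omega,0,\omega^2,1,1,\omega^2,0,\omega)$, $(0,0,0,0,1,\omega^2,\omega^2,\omega^2,1,0,\omega^2)$,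 $(0,0,0,0,\omega,\omega,1,0,1,\omega,\omega)$. -}

module Defs where

open import Data.Nat using (ℕ; zero; suc)
open import Data.Bool using (Bool; true; false)
open import Data.Vec using (Vec; []; _∷_; zipWith; replicate; foldr)
open import Data.List using (List; length)
open import Data.List.Relation.Unary.Any using (Any)
open import Data.List.Relation.Unary.AllPairs using (AllPairs)
open import Data.Product using (Σ; _×_; ∃-syntax)
open import Relation.Nullary using (¬_)
open import Relation.Binary.PropositionalEquality using (_≡_)

-- The field F4 = {0, 1, ω, ω²} with ω² = ω + 1 (only addition is needed:
-- additive codes are F2-subspaces).

data F4 : Set where
  𝟎 𝟏 ω ω² : F4

infixl 6 _⊕_
_⊕_ : F4 → F4 → F4
𝟎  ⊕ y  = y
x  ⊕ 𝟎  = x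
𝟏  ⊕ 𝟏  = 𝟎
𝟏  ⊕ ω  = ω²
𝟏  ⊕ ω² = ω
ω  ⊕ 𝟏  = ω²
ω  ⊕ ω  = 𝟎
ω  ⊕ ω² = 𝟏
ω² ⊕ 𝟏  = ω
ω² ⊕ ω  = 𝟏
ω² ⊕ ω² = 𝟎

Word : Set
Word = Vec F4 11

infixl 6 _+ᵥ_
_+ᵥ_ : Word → Word → Word
_+ᵥ_ = zipWith _⊕_

zeroW : Word
zeroW = replicate 11 𝟎

wt : ∀ {n} → Vec F4 n → ℕ
wt []        = 0
wt (𝟎 ∷ xs)  = wt xs
wt (_ ∷ xs)  = suc (wt xs)

gens : Vec Word 12
gens =
    (𝟎 ∷ 𝟎 ∷ 𝟎 ∷ 𝟎 ∷ 𝟎 ∷ ω² ∷ ω² ∷ 𝟎 ∷ ω ∷ 𝟏 ∷ ω ∷ [])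
  ∷ (𝟎 ∷ 𝟎 ∷ 𝟎 ∷ 𝟎 ∷ 𝟎 ∷ ω ∷ 𝟎 ∷ ω ∷ ω ∷ ω ∷ 𝟏 ∷ [])
  ∷ (𝟏 ∷ 𝟎 ∷ 𝟎 ∷ 𝟎 ∷ 𝟎 ∷ 𝟏 ∷ 𝟎 ∷ 𝟏 ∷ ω² ∷ ω² ∷ 𝟏 ∷ [])
  ∷ (ω ∷ 𝟎 ∷ 𝟎 ∷ 𝟎 ∷ 𝟎 ∷ 𝟎 ∷ ω ∷ 𝟏 ∷ ω ∷ ω ∷ ω ∷ [])
  ∷ (𝟎 ∷ 𝟏 ∷ 𝟎 ∷ 𝟎 ∷ 𝟎 ∷ 𝟎 ∷ 𝟏 ∷ 𝟏 ∷ 𝟏 ∷ ω² ∷ ω² ∷ [])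
  ∷ (𝟎 ∷ ω ∷ 𝟎 ∷ 𝟎 ∷ 𝟎 ∷ ω² ∷ 𝟏 ∷ ω² ∷ ω ∷ ω ∷ 𝟎 ∷ [])
  ∷ (𝟎 ∷ 𝟎 ∷ 𝟏 ∷ 𝟎 ∷ 𝟎 ∷ ω ∷ ω ∷ 𝟏 ∷ 𝟏 ∷ 𝟎 ∷ 𝟏 ∷ [])
  ∷ (𝟎 ∷ 𝟎 ∷ ω ∷ 𝟎 ∷ 𝟎 ∷ ω ∷ 𝟏 ∷ ω ∷ ω² ∷ ω² ∷ 𝟎 ∷ [])
  ∷ (𝟎 ∷ 𝟎 ∷ 𝟎 ∷ 𝟏 ∷ 𝟎 ∷ ω ∷ ω ∷ ω ∷ 𝟎 ∷ 𝟏 ∷ ω ∷ [])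
  ∷ (𝟎 ∷ 𝟎 ∷ 𝟎 ∷ ω ∷ 𝟎 ∷ ω² ∷ 𝟏 ∷ 𝟏 ∷ ω² ∷ 𝟎 ∷ ω ∷ [])
  ∷ (𝟎 ∷ 𝟎 ∷ 𝟎 ∷ 𝟎 ∷ 𝟏 ∷ ω² ∷ ω² ∷ ω² ∷ 𝟏 ∷ 𝟎 ∷ ω² ∷ [])
  ∷ (𝟎 ∷ 𝟎 ∷ 𝟎 ∷ 𝟎 ∷ ω ∷ ω ∷ 𝟏 ∷ 𝟎 ∷ 𝟏 ∷ ω ∷ ω ∷ [])
  ∷ []

lincomb : ∀ {k} → Vec Bool k → Vec Word k → Word
lincomb []           []        = zeroW
lincomb (true  ∷ cs) (g ∷ gs)  = g +ᵥ lincomb cs gs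
lincomb (false ∷ cs) (_ ∷ gs)  = lincomb cs gs

InD⁻ : Word → Set
InD⁻ w = Σ (Vec Bool 12) (λ c → lincomb c gens ≡ w)

-- The coset graph Γ = Γ_{D⁻}. Vertices are cosets x + D⁻, represented by
-- words x; two words represent the same coset iff x - y ∈ D⁻
-- (in characteristic 2, x - y = x + y).

SameCoset : Word → Word → Set
SameCoset x y = InD⁻ (x +ᵥ y)

-- x + D⁻ and y + D⁻ adjacent iff (x - y) + D⁻ contains a weight-1 vector
Adj : Word → Word → Set
Adj x y = ∃[ e ] (wt e ≡ 1 × InD⁻ (x +ᵥ y +ᵥ e))

Dist2 : Word → Word → Set
Dist2 x y = ¬ SameCoset x y × ¬ Adj x y × ∃[ z ] (Adj x z × Adj z y)

data CountIs {A : Set} (P : A → Set) : List A → ℕ → Set where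
  []   : CountIs P List.[] 0
  yes  : ∀ {x xs k} → P x   → CountIs P xs k → CountIs P (x List.∷ xs) (suc k)
  no   : ∀ {x xs k} → ¬ P x → CountIs P xs k → CountIs P (x List.∷ xs) k

IsTransversal : {V : Set} → (V → V → Set) → List V → Set
IsTransversal {V} _≈_ reps =
  (∀ v → Any (v ≈_) reps) × AllPairs (λ a b → ¬ a ≈ b) reps

-- Strongly regular with parameters (ν,κ,λ,μ), for a graph whose vertex set
-- is the quotient V/≈ (enumerated by a transversal reps) and whose
-- adjacency R is a relation on representatives (compatible with ≈).
IsSRG : {V : Set} → (V → V → Set) → (V → V → Set) → List V →
        ℕ → ℕ → ℕ → ℕ → Set
IsSRG _≈_ R reps ν κ λ' μ =
    length reps ≡ ν
  × (∀ x → CountIs (R x) reps κ)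
  × (∀ x y → R x y → CountIs (λ z → R x z × R z y) reps λ')
  × (∀ x y → ¬ x ≈ y → ¬ R x y → CountIs (λ z → R x z × R z y) reps μ)

StronglyRegular : {V : Set} → (V → V → Set) → (V → V → Set) →
                  ℕ → ℕ → ℕ → ℕ → Set
StronglyRegular {V} _≈_ R ν κ λ' μ =
  Σ (List V) (λ reps → IsTransversal _≈_ reps × IsSRG _≈_ R reps ν κ λ' μ)

{-# OPTIONS --safe #-}

-- The first six coordinates form an information set of D⁻, so D⁻ has a
-- parity check ("syndrome") map onto F4⁵ and its coset graph is a Cayley graph
-- on F4⁵.  The distance-2 graph is then the Cayley graph of an explicit set
-- S ⊆ F4⁵ of 495 elements, and strong regularity says that the number of
-- z ∈ S with z + d ∈ S is 495, 238 or 240 according to whether d = 0, d ∈ S or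
-- neither.  These 1024 numbers are found by evaluation.

module Submission where

open import Defs

open import Algebra.Bundles using (CommutativeSemigroup)
open import Algebra.Definitions using (Associative; Commutative; RightIdentity)
open import Data.Bool using (Bool; true; false; T; T?; _xor_; if_then_else_)
open import Data.Fin using (#_)
open import Data.Fin.Subset using (⁅_⁆; _∪_; ⊥)
open import Data.List using (List; []; _∷_; _++_; map; cartesianProductWith)
open import Data.List.Membership.Propositional using (_∈_; find; lose)
open import Data.List.Membership.Propositional.Properties using (∈-map⁺; ∈-map⁻; ∈-cartesianProductWith⁺)
open import Data.List.Relation.Unary.All as All using (All; []; _∷_)
open import Data.List.Relation.Unary.AllPairs as AllPairs using ([]; _∷_)
import Data.List.Relation.Unary.AllPairs.Properties as AllPairs
open import Data.List.Relation.Unary.Any as Any using (Any; here; there)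
open import Data.List.Relation.Unary.Unique.Propositional using (Unique)
open import Data.List.Relation.Unary.Unique.Propositional.Properties using (cartesianProductWith⁺)
open import Data.Nat as ℕ using (ℕ; zero; suc; _+_)
import Data.Nat.Properties as ℕ
open import Data.Nat.Solver using (module +-*-Solver)
open import Data.Product using (_×_; _,_; proj₁; proj₂; ∃-syntax)
open import Data.Unit using (tt)
open import Data.Vec as Vec using (Vec; []; _∷_; zipWith; replicate)
open import Data.Vec.Properties using (zipWith-assoc; zipWith-comm; zipWith-identityˡ; zipWith-identityʳ; ≡-dec; ∷-injective)
open import Data.Vec.Relation.Unary.All as VecAll using ([]; _∷_)
open import Function using (_∘_)
open import Function.Bundles using (_⇔_; mk⇔; Equivalence)
open import Relation.Binary.Definitions using (DecidableEquality)
open import Relation.Binary.PropositionalEquality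
open import Relation.Nullary using (¬_; Dec; does; contradiction) renaming (yes to yes′; no to no′)
open import Relation.Nullary.Decidable using (¬?; _×-dec_; toWitness; map′)
open import Relation.Unary using (Decidable)

open Equivalence using (to; from)

-- Words over F4

infix 4 _≟_
_≟_ : DecidableEquality F4
𝟎  ≟ 𝟎  = yes′ refl
𝟎  ≟ 𝟏  = no′ λ ()
𝟎  ≟ ω  = no′ λ ()
𝟎  ≟ ω² = no′ λ ()
𝟏  ≟ 𝟎  = no′ λ ()
𝟏  ≟ 𝟏  = yes′ refl
𝟏  ≟ ω  = no′ λ ()
𝟏  ≟ ω² = no′ λ ()
ω  ≟ 𝟎  = no′ λ ()
ω  ≟ 𝟏  = no′ λ ()
ω  ≟ ω  = yes′ refl
ω  ≟ ω² = no′ λ ()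
ω² ≟ 𝟎  = no′ λ ()
ω² ≟ 𝟏  = no′ λ ()
ω² ≟ ω  = no′ λ ()
ω² ≟ ω² = yes′ refl

all? : {P : F4 → Set} → Decidable P → Dec (∀ x → P x)
all? P? = map′ (λ { (a , b , c , d) → λ { 𝟎 → a ; 𝟏 → b ; ω → c ; ω² → d } })
               (λ p → p 𝟎 , p 𝟏 , p ω , p ω²)
               (P? 𝟎 ×-dec P? 𝟏 ×-dec P? ω ×-dec P? ω²)

⊕-assoc : Associative _≡_ _⊕_
⊕-assoc = toWitness {a? = all? λ x → all? λ y → all? λ z → (x ⊕ y) ⊕ z ≟ x ⊕ (y ⊕ z)} _

⊕-comm : Commutative _≡_ _⊕_
⊕-comm = toWitness {a? = all? λ x → all? λ y → x ⊕ y ≟ y ⊕ x} _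

⊕-identityʳ : RightIdentity _≡_ 𝟎 _⊕_
⊕-identityʳ = toWitness {a? = all? λ x → x ⊕ 𝟎 ≟ x} _

⊕-self : ∀ x → x ⊕ x ≡ 𝟎
⊕-self = toWitness {a? = all? λ x → x ⊕ x ≟ 𝟎} _

infixl 6 _⊞_
_⊞_ : ∀ {n} → Vec F4 n → Vec F4 n → Vec F4 n
_⊞_ = zipWith _⊕_

𝟘 : ∀ {n} → Vec F4 n
𝟘 = replicate _ 𝟎

⊞-assoc : ∀ {n} (x y z : Vec F4 n) → (x ⊞ y) ⊞ z ≡ x ⊞ (y ⊞ z)
⊞-assoc = zipWith-assoc ⊕-assoc

⊞-comm : ∀ {n} (x y : Vec F4 n) → x ⊞ y ≡ y ⊞ x
⊞-comm = zipWith-comm ⊕-comm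

⊞-identityˡ : ∀ {n} (x : Vec F4 n) → 𝟘 ⊞ x ≡ x
⊞-identityˡ = zipWith-identityˡ λ _ → refl

⊞-identityʳ : ∀ {n} (x : Vec F4 n) → x ⊞ 𝟘 ≡ x
⊞-identityʳ = zipWith-identityʳ ⊕-identityʳ

⊞-self : ∀ {n} (x : Vec F4 n) → x ⊞ x ≡ 𝟘
⊞-self []      = refl
⊞-self (x ∷ v) = cong₂ _∷_ (⊕-self x) (⊞-self v)

⊞-commutativeSemigroup : ℕ → CommutativeSemigroup _ _
⊞-commutativeSemigroup n = record
  { Carrier = Vec F4 n
  ; isCommutativeSemigroup = record
    { isSemigroup = record
      { isMagma = record { isEquivalence = isEquivalence ; ∙-cong = cong₂ _⊞_ }
      ; assoc   = ⊞-assoc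
      }
    ; comm = ⊞-comm
    }
  }

module _ {n : ℕ} where
  open import Algebra.Properties.CommutativeSemigroup (⊞-commutativeSemigroup n) public
    using () renaming (interchange to ⊞-interchange)

⊞-cancelˡ : ∀ {n} (x y : Vec F4 n) → x ⊞ (x ⊞ y) ≡ y
⊞-cancelˡ x y = begin
  x ⊞ (x ⊞ y)  ≡⟨ ⊞-assoc x x y ⟨
  (x ⊞ x) ⊞ y  ≡⟨ cong (_⊞ y) (⊞-self x) ⟩
  𝟘 ⊞ y        ≡⟨ ⊞-identityˡ y ⟩
  y            ∎
  where open ≡-Reasoning

-- In characteristic 2 a sum is also a difference, and differences are invariant under translation
-- by `x`.
⊞-cancel-middle : ∀ {n} (x y z : Vec F4 n) → (x ⊞ y) ⊞ (x ⊞ z) ≡ y ⊞ z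
⊞-cancel-middle x y z = begin
  (x ⊞ y) ⊞ (x ⊞ z)  ≡⟨ ⊞-interchange x y x z ⟩
  (x ⊞ x) ⊞ (y ⊞ z)  ≡⟨ ⊞-assoc x x (y ⊞ z) ⟩
  x ⊞ (x ⊞ (y ⊞ z))  ≡⟨ ⊞-cancelˡ x (y ⊞ z) ⟩
  y ⊞ z              ∎
  where open ≡-Reasoning

⊞≡𝟘⇒≡ : ∀ {n} {x y : Vec F4 n} → x ⊞ y ≡ 𝟘 → x ≡ y
⊞≡𝟘⇒≡ {x = x} {y} eq = begin
  x            ≡⟨ ⊞-identityʳ x ⟨
  x ⊞ 𝟘        ≡⟨ cong (x ⊞_) eq ⟨
  x ⊞ (x ⊞ y)  ≡⟨ ⊞-cancelˡ x y ⟩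
  y            ∎
  where open ≡-Reasoning

-- Additive maps

-- An additive map F4ⁿ → F4ᵐ, given by the images of 1 and ω in each coordinate.
Matrix : ℕ → ℕ → Set
Matrix n m = Vec (Vec F4 m × Vec F4 m) n

-- An additive map need not be F4-linear, so `p` and `q` are independent; the value at `ω²` is
-- forced by ω² = ω + 1.
scale : ∀ {m} → F4 → Vec F4 m × Vec F4 m → Vec F4 m
scale 𝟎  (p , q) = 𝟘
scale 𝟏  (p , q) = p
scale ω  (p , q) = q
scale ω² (p , q) = p ⊞ q

infixr 7 _·_
_·_ : ∀ {n m} → Vec F4 n → Matrix n m → Vec F4 m
[]      · []      = 𝟘
(x ∷ v) · (c ∷ M) = scale x c ⊞ v · M

scale-⊕ : ∀ {m} x y (c : Vec F4 m × Vec F4 m) → scale (x ⊕ y) c ≡ scale x c ⊞ scale y c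
scale-⊕ 𝟎  y  c       = sym (⊞-identityˡ _)
scale-⊕ 𝟏  𝟎  c       = sym (⊞-identityʳ _)
scale-⊕ 𝟏  𝟏  (p , q) = sym (⊞-self p)
scale-⊕ 𝟏  ω  (p , q) = refl
scale-⊕ 𝟏  ω² (p , q) = sym (⊞-cancelˡ p q)
scale-⊕ ω  𝟎  c       = sym (⊞-identityʳ _)
scale-⊕ ω  𝟏  (p , q) = ⊞-comm p q
scale-⊕ ω  ω  (p , q) = sym (⊞-self q)
scale-⊕ ω  ω² (p , q) = sym (trans (cong (q ⊞_) (⊞-comm p q)) (⊞-cancelˡ q p))
scale-⊕ ω² 𝟎  c       = sym (⊞-identityʳ _)
scale-⊕ ω² 𝟏  (p , q) = sym (trans (⊞-comm (p ⊞ q) p) (⊞-cancelˡ p q))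
scale-⊕ ω² ω  (p , q) = sym (trans (⊞-comm (p ⊞ q) q) (trans (cong (q ⊞_) (⊞-comm p q)) (⊞-cancelˡ q p)))
scale-⊕ ω² ω² (p , q) = sym (⊞-self (p ⊞ q))

·-⊞ : ∀ {n m} (v w : Vec F4 n) (M : Matrix n m) → (v ⊞ w) · M ≡ v · M ⊞ w · M
·-⊞ []      []      []      = sym (⊞-self 𝟘)
·-⊞ (x ∷ v) (y ∷ w) (c ∷ M) =
  trans (cong₂ _⊞_ (scale-⊕ x y c) (·-⊞ v w M)) (⊞-interchange (scale x c) _ _ _)

mapColumns : ∀ {n m m′} → (Vec F4 m → Vec F4 m′) → Matrix n m → Matrix n m′
mapColumns f = Vec.map λ (p , q) → f p , f q

module _ {m m′} (f : Vec F4 m → Vec F4 m′) (f-⊞ : ∀ x y → f (x ⊞ y) ≡ f x ⊞ f y) (f-𝟘 : f 𝟘 ≡ 𝟘) where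

  f-scale : ∀ x c → f (scale x c) ≡ scale x (f (proj₁ c) , f (proj₂ c))
  f-scale 𝟎  c       = f-𝟘
  f-scale 𝟏  c       = refl
  f-scale ω  c       = refl
  f-scale ω² (p , q) = f-⊞ p q

  ·-mapColumns : ∀ {n} (v : Vec F4 n) M → v · mapColumns f M ≡ f (v · M)
  ·-mapColumns []      []      = sym f-𝟘
  ·-mapColumns (x ∷ v) (c ∷ M) =
    trans (cong₂ _⊞_ (sym (f-scale x c)) (·-mapColumns v M)) (sym (f-⊞ (scale x c) (v · M)))

_⊞ᴹ_ : ∀ {n m} → Matrix n m → Matrix n m → Matrix n m
_⊞ᴹ_ = zipWith λ (p , q) (p′ , q′) → p ⊞ p′ , q ⊞ q′

scale-⊞ᴹ : ∀ {m} x (p q p′ q′ : Vec F4 m) →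
           scale x (p ⊞ p′ , q ⊞ q′) ≡ scale x (p , q) ⊞ scale x (p′ , q′)
scale-⊞ᴹ 𝟎  p q p′ q′ = sym (⊞-self 𝟘)
scale-⊞ᴹ 𝟏  p q p′ q′ = refl
scale-⊞ᴹ ω  p q p′ q′ = refl
scale-⊞ᴹ ω² p q p′ q′ = ⊞-interchange p p′ q q′

·-⊞ᴹ : ∀ {n m} (v : Vec F4 n) (M N : Matrix n m) → v · (M ⊞ᴹ N) ≡ v · M ⊞ v · N
·-⊞ᴹ []      []      []      = sym (⊞-self 𝟘)
·-⊞ᴹ (x ∷ v) ((p , q) ∷ M) ((p′ , q′) ∷ N) =
  trans (cong₂ _⊞_ (scale-⊞ᴹ x p q p′ q′) (·-⊞ᴹ v M N)) (⊞-interchange (scale x (p , q)) _ _ _)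

identity : ∀ n → Matrix n n
identity zero    = []
identity (suc n) = (𝟏 ∷ 𝟘 , ω ∷ 𝟘) ∷ mapColumns (𝟎 ∷_) (identity n)

scale-unit : ∀ {n} x → scale {suc n} x (𝟏 ∷ 𝟘 , ω ∷ 𝟘) ≡ x ∷ 𝟘
scale-unit 𝟎  = refl
scale-unit 𝟏  = refl
scale-unit ω  = refl
scale-unit ω² = cong (ω² ∷_) (⊞-self 𝟘)

·-identity : ∀ {n} (v : Vec F4 n) → v · identity n ≡ v
·-identity []      = refl
·-identity (x ∷ v) = begin
  scale x _ ⊞ v · mapColumns (𝟎 ∷_) (identity _)
    ≡⟨ cong₂ _⊞_ (scale-unit x) (·-mapColumns (𝟎 ∷_) (λ _ _ → refl) refl v (identity _)) ⟩
  (x ⊕ 𝟎) ∷ (𝟘 ⊞ v · identity _)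
    ≡⟨ cong₂ _∷_ (⊕-identityʳ x) (trans (⊞-identityˡ _) (·-identity v)) ⟩
  x ∷ v
    ∎
  where open ≡-Reasoning

-- Syndromes

pad : Vec F4 5 → Word
pad s = 𝟎 ∷ 𝟎 ∷ 𝟎 ∷ 𝟎 ∷ 𝟎 ∷ 𝟎 ∷ s

-- The entries over the first six coordinates u are forced: the codeword
-- starting with u is u followed by the syndrome of (u , 0).
parityCheck : Matrix 11 5
parityCheck =
    (ω² ∷ ω² ∷ ω² ∷ 𝟎  ∷ ω  ∷ [] , ω ∷ 𝟏  ∷ ω  ∷ ω  ∷ ω  ∷ [])
  ∷ (𝟏  ∷ 𝟏  ∷ 𝟏  ∷ ω² ∷ ω² ∷ [] , ω ∷ ω² ∷ 𝟎  ∷ ω² ∷ ω  ∷ [])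
  ∷ (ω  ∷ ω² ∷ ω² ∷ ω  ∷ 𝟎  ∷ [] , 𝟏 ∷ 𝟎  ∷ 𝟏  ∷ 𝟏  ∷ 𝟏  ∷ [])
  ∷ (ω  ∷ 𝟎  ∷ ω  ∷ ω² ∷ ω² ∷ [] , ω ∷ 𝟏  ∷ 𝟏  ∷ 𝟏  ∷ 𝟎  ∷ [])
  ∷ (𝟎  ∷ ω² ∷ ω² ∷ 𝟏  ∷ 𝟏  ∷ [] , 𝟏 ∷ ω  ∷ ω² ∷ 𝟎  ∷ ω² ∷ [])
  ∷ (ω² ∷ ω  ∷ 𝟎  ∷ ω² ∷ ω² ∷ [] , 𝟎 ∷ ω  ∷ ω  ∷ ω  ∷ 𝟏  ∷ [])
  ∷ identity 5

syn : Word → Vec F4 5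
syn w = w · parityCheck

syn-⊞ : ∀ x y → syn (x ⊞ y) ≡ syn x ⊞ syn y
syn-⊞ x y = ·-⊞ x y parityCheck

syn-pad : ∀ s → syn (pad s) ≡ s
syn-pad s = begin
  𝟘 ⊞ (𝟘 ⊞ (𝟘 ⊞ (𝟘 ⊞ (𝟘 ⊞ (𝟘 ⊞ t)))))
    ≡⟨ cong (λ v → 𝟘 ⊞ (𝟘 ⊞ (𝟘 ⊞ v))) (drop-𝟘s t) ⟩
  𝟘 ⊞ (𝟘 ⊞ (𝟘 ⊞ t))
    ≡⟨ drop-𝟘s t ⟩
  t
    ≡⟨ ·-identity s ⟩
  s
    ∎
  where
  open ≡-Reasoning
  t = s · identity 5
  drop-𝟘s : ∀ v → 𝟘 ⊞ (𝟘 ⊞ (𝟘 ⊞ v)) ≡ v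
  drop-𝟘s v = trans (⊞-identityˡ _) (trans (⊞-identityˡ _) (⊞-identityˡ v))

-- D⁻ as the kernel of the syndrome map

syn-lincomb : ∀ {k} {gs : Vec Word k} → VecAll.All (λ g → syn g ≡ 𝟘) gs →
              ∀ c → syn (lincomb c gs) ≡ 𝟘
syn-lincomb []       []          = refl
syn-lincomb (_ ∷ zs) (false ∷ c) = syn-lincomb zs c
syn-lincomb {gs = g ∷ _} (z ∷ zs) (true ∷ c) =
  trans (syn-⊞ g _) (trans (cong₂ _⊞_ z (syn-lincomb zs c)) (⊞-self 𝟘))

InD⁻⇒syn≡𝟘 : ∀ {w} → InD⁻ w → syn w ≡ 𝟘
InD⁻⇒syn≡𝟘 (c , refl) = syn-lincomb
  -- Each `refl` evaluates the syndrome of one of the twelve generators.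
  (refl ∷ refl ∷ refl ∷ refl ∷ refl ∷ refl ∷ refl ∷ refl ∷ refl ∷ refl ∷ refl ∷ refl ∷ []) c

-- Where both coefficients are `true` the generator occurs twice and cancels. This makes D⁻ closed
-- under addition.
lincomb-xor : ∀ {k} (gs : Vec Word k) c c′ →
              lincomb (zipWith _xor_ c c′) gs ≡ lincomb c gs ⊞ lincomb c′ gs
lincomb-xor []       []          []           = refl
lincomb-xor (g ∷ gs) (false ∷ c) (false ∷ c′) = lincomb-xor gs c c′
lincomb-xor (g ∷ gs) (true  ∷ c) (false ∷ c′) =
  trans (cong (g ⊞_) (lincomb-xor gs c c′)) (sym (⊞-assoc g _ _))
lincomb-xor (g ∷ gs) (false ∷ c) (true  ∷ c′) = begin
  g ⊞ lincomb (zipWith _xor_ c c′) gs  ≡⟨ cong (g ⊞_) (lincomb-xor gs c c′) ⟩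
  g ⊞ (l ⊞ l′)                         ≡⟨ ⊞-assoc g l l′ ⟨
  (g ⊞ l) ⊞ l′                         ≡⟨ cong (_⊞ l′) (⊞-comm g l) ⟩
  (l ⊞ g) ⊞ l′                         ≡⟨ ⊞-assoc l g l′ ⟩
  l ⊞ (g ⊞ l′)                         ∎
  where
  open ≡-Reasoning
  l  = lincomb c gs
  l′ = lincomb c′ gs
lincomb-xor (g ∷ gs) (true  ∷ c) (true  ∷ c′) =
  trans (lincomb-xor gs c c′) (sym (⊞-cancel-middle g _ _))

InD⁻-⊞ : ∀ {v w} → InD⁻ v → InD⁻ w → InD⁻ (v ⊞ w)
InD⁻-⊞ (c , refl) (c′ , refl) = zipWith _xor_ c c′ , lincomb-xor gens c c′

-- A subset of the index set is a vector of Booleans, so subsets serve as coefficient vectors; `⊥`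
-- is the zero combination.
InD⁻-𝟘 : InD⁻ 𝟘
InD⁻-𝟘 = ⊥ , refl

-- Each `v · M` is a sum of listed images, so a claim about all words reduces to finitely many
-- membership checks.
InD⁻-· : ∀ {n} {M : Matrix n 11} → VecAll.All (λ (p , q) → InD⁻ p × InD⁻ q) M →
         ∀ v → InD⁻ (v · M)
InD⁻-· []             []      = InD⁻-𝟘
InD⁻-· {M = _ ∷ _} ((p , q) ∷ cs) (x ∷ v) = InD⁻-⊞ (scaled x) (InD⁻-· cs v)
  where
  scaled : ∀ x → InD⁻ (scale x _)
  scaled 𝟎  = InD⁻-𝟘
  scaled 𝟏  = p
  scaled ω  = q
  scaled ω² = InD⁻-⊞ p q

padded : Matrix 11 11
padded = mapColumns pad parityCheck

-- Generators 2 to 11 carry 1 or ω in one of the first five coordinates. Generators 0 and 1 vanish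
-- on those five and are added to clear the sixth; they also give the sixth column by themselves. In
-- the last five columns the identity and the padded parity check cancel.
columns∈D⁻ : VecAll.All (λ (p , q) → InD⁻ p × InD⁻ q) (identity 11 ⊞ᴹ padded)
columns∈D⁻ =
    ((⁅ # 0 ⁆ ∪ ⁅ # 1 ⁆ ∪ ⁅ # 2 ⁆ , refl) , (⁅ # 3 ⁆           , refl))
  ∷ ((⁅ # 4 ⁆                     , refl) , (⁅ # 0 ⁆ ∪ ⁅ # 5 ⁆ , refl))
  ∷ ((⁅ # 1 ⁆ ∪ ⁅ # 6 ⁆           , refl) , (⁅ # 1 ⁆ ∪ ⁅ # 7 ⁆ , refl))
  ∷ ((⁅ # 1 ⁆ ∪ ⁅ # 8 ⁆           , refl) , (⁅ # 0 ⁆ ∪ ⁅ # 9 ⁆ , refl))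
  ∷ ((⁅ # 0 ⁆ ∪ ⁅ # 10 ⁆          , refl) , (⁅ # 1 ⁆ ∪ ⁅ # 11 ⁆ , refl))
  ∷ ((⁅ # 0 ⁆ ∪ ⁅ # 1 ⁆           , refl) , (⁅ # 1 ⁆           , refl))
  ∷ (InD⁻-𝟘 , InD⁻-𝟘) ∷ (InD⁻-𝟘 , InD⁻-𝟘) ∷ (InD⁻-𝟘 , InD⁻-𝟘)
  ∷ (InD⁻-𝟘 , InD⁻-𝟘) ∷ (InD⁻-𝟘 , InD⁻-𝟘) ∷ []

-- The map taking `w` to `w ⊞ pad (syn w)` is additive with matrix `identity 11 ⊞ᴹ padded`, whose
-- columns lie in D⁻. Hence every coset has a canonical representative, and a word with zero
-- syndrome lies in D⁻.
SameCoset-pad-syn : ∀ w → SameCoset w (pad (syn w))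
SameCoset-pad-syn w = subst InD⁻ eq (InD⁻-· columns∈D⁻ w)
  where
  eq : w · (identity 11 ⊞ᴹ padded) ≡ w ⊞ pad (syn w)
  eq = trans (·-⊞ᴹ w (identity 11) padded)
             (cong₂ _⊞_ (·-identity w) (·-mapColumns pad (λ _ _ → refl) refl w parityCheck))

syn≡𝟘⇒InD⁻ : ∀ {w} → syn w ≡ 𝟘 → InD⁻ w
syn≡𝟘⇒InD⁻ {w} eq = subst InD⁻ (trans (cong (λ s → w ⊞ pad s) eq) (⊞-identityʳ w)) (SameCoset-pad-syn w)

SameCoset⇔ : ∀ x y → SameCoset x y ⇔ syn x ⊞ syn y ≡ 𝟘
SameCoset⇔ x y = mk⇔ (trans (sym (syn-⊞ x y)) ∘ InD⁻⇒syn≡𝟘) (syn≡𝟘⇒InD⁻ ∘ trans (syn-⊞ x y))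

-- Adjacency and distance 2 in terms of syndromes

units : ∀ n → List (Vec F4 n)
units zero    = []
units (suc n) = (𝟏 ∷ 𝟘) ∷ (ω ∷ 𝟘) ∷ (ω² ∷ 𝟘) ∷ map (𝟎 ∷_) (units n)

wt≡0⇒≡𝟘 : ∀ {n} (v : Vec F4 n) → wt v ≡ 0 → v ≡ 𝟘
wt≡0⇒≡𝟘 []       eq = refl
wt≡0⇒≡𝟘 (𝟎 ∷ v)  eq = cong (𝟎 ∷_) (wt≡0⇒≡𝟘 v eq)

wt-𝟘 : ∀ n → wt (𝟘 {n}) ≡ 0
wt-𝟘 zero    = refl
wt-𝟘 (suc n) = wt-𝟘 n

wt≡1⇒∈units : ∀ {n} (v : Vec F4 n) → wt v ≡ 1 → v ∈ units n
wt≡1⇒∈units (𝟎  ∷ v) eq = there (there (there (∈-map⁺ (𝟎 ∷_) (wt≡1⇒∈units v eq))))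
wt≡1⇒∈units (𝟏  ∷ v) eq = here (cong (𝟏 ∷_) (wt≡0⇒≡𝟘 v (ℕ.suc-injective eq)))
wt≡1⇒∈units (ω  ∷ v) eq = there (here (cong (ω ∷_) (wt≡0⇒≡𝟘 v (ℕ.suc-injective eq))))
wt≡1⇒∈units (ω² ∷ v) eq = there (there (here (cong (ω² ∷_) (wt≡0⇒≡𝟘 v (ℕ.suc-injective eq)))))

∈units⇒wt≡1 : ∀ {n} {v : Vec F4 n} → v ∈ units n → wt v ≡ 1
∈units⇒wt≡1 {suc n} (here refl)                 = cong suc (wt-𝟘 n)
∈units⇒wt≡1 {suc n} (there (here refl))         = cong suc (wt-𝟘 n)
∈units⇒wt≡1 {suc n} (there (there (here refl))) = cong suc (wt-𝟘 n)
∈units⇒wt≡1 {suc n} (there (there (there v∈))) with ∈-map⁻ (𝟎 ∷_) v∈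
... | _ , u∈ , refl = ∈units⇒wt≡1 u∈

-- Opaque (as is S₂ below): otherwise conversion checking enumerates the set.
opaque

  S₁ : List (Vec F4 5)
  S₁ = map syn (units 11)

  -- As D⁻ is the kernel of `syn`, adjacency asks for a weight-1 word with the syndrome of x - y. So
  -- Γ is the Cayley graph with connection set `S₁`.
  Adj⇔ : ∀ x y → Adj x y ⇔ syn x ⊞ syn y ∈ S₁
  Adj⇔ x y = mk⇔ adj⇒∈ ∈⇒adj
    where
    syn-sum : ∀ e → syn (x ⊞ y ⊞ e) ≡ (syn x ⊞ syn y) ⊞ syn e
    syn-sum e = trans (syn-⊞ (x ⊞ y) e) (cong (_⊞ syn e) (syn-⊞ x y))
    adj⇒∈ : Adj x y → syn x ⊞ syn y ∈ S₁
    adj⇒∈ (e , wt≡1 , e∈) = subst (_∈ S₁)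
      (sym (⊞≡𝟘⇒≡ (trans (sym (syn-sum e)) (InD⁻⇒syn≡𝟘 e∈)))) (∈-map⁺ syn (wt≡1⇒∈units e wt≡1))
    ∈⇒adj : syn x ⊞ syn y ∈ S₁ → Adj x y
    ∈⇒adj s∈ with ∈-map⁻ syn s∈
    ... | e , e∈ , eq = e , ∈units⇒wt≡1 e∈ ,
      syn≡𝟘⇒InD⁻ (trans (syn-sum e) (trans (cong (_⊞ syn e) eq) (⊞-self (syn e))))

-- The vertices at distance 2 from zero in the Cayley graph with connection set `xs`; the last
-- clause writes `d` as a sum of two elements of `xs`.
Distant : ∀ {n} → List (Vec F4 n) → Vec F4 n → Set
Distant xs d = ¬ d ≡ 𝟘 × ¬ d ∈ xs × Any (λ a → d ⊞ a ∈ xs) xs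

Dist2⇔ : ∀ x y → Dist2 x y ⇔ Distant S₁ (syn x ⊞ syn y)
Dist2⇔ x y = mk⇔
  (λ (x≉y , x≁y , z , x~z , z~y) →
      x≉y ∘ from (SameCoset⇔ x y)
    , x≁y ∘ from (Adj⇔ x y)
    , lose (to (Adj⇔ x z) x~z) (subst (_∈ S₁) (through z) (to (Adj⇔ z y) z~y)))
  (λ (d≢𝟘 , d∉S₁ , via) →
      d≢𝟘 ∘ to (SameCoset⇔ x y)
    , d∉S₁ ∘ to (Adj⇔ x y)
    , midpoint (find via))
  where
  -- The second step of a path is its total difference minus the first step.
  through : ∀ z → syn z ⊞ syn y ≡ (syn x ⊞ syn y) ⊞ (syn x ⊞ syn z)
  through z = trans (⊞-comm (syn z) (syn y)) (sym (⊞-cancel-middle (syn x) (syn y) (syn z)))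

  midpoint : ∃[ a ] (a ∈ S₁ × (syn x ⊞ syn y) ⊞ a ∈ S₁) → ∃[ z ] (Adj x z × Adj z y)
  midpoint (a , a∈ , d+a∈) = z ,
    from (Adj⇔ x z) (subst (_∈ S₁) (sym x+z≡a) a∈) ,
    from (Adj⇔ z y) (subst (_∈ S₁) (trans (cong ((syn x ⊞ syn y) ⊞_) (sym x+z≡a)) (sym (through z))) d+a∈)
    where
    -- Since `syn (pad a)` is `a`, adding `pad a` moves the syndrome of `x` by exactly `a`.
    z = x ⊞ pad a
    x+z≡a : syn x ⊞ syn z ≡ a
    x+z≡a = begin
      syn x ⊞ syn z                  ≡⟨ cong (syn x ⊞_) (syn-⊞ x (pad a)) ⟩
      syn x ⊞ (syn x ⊞ syn (pad a))  ≡⟨ ⊞-cancelˡ (syn x) _ ⟩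
      syn (pad a)                    ≡⟨ syn-pad a ⟩
      a                              ∎
      where open ≡-Reasoning

-- Subsets of F4ⁿ as tries

data Trie : ℕ → Set where
  leaf : Bool → Trie 0
  node : ∀ {n} (t₀ t₁ t₂ t₃ : Trie n) → Trie (suc n)

child : ∀ {n} → Trie (suc n) → F4 → Trie n
child (node t₀ t₁ t₂ t₃) 𝟎  = t₀
child (node t₀ t₁ t₂ t₃) 𝟏  = t₁
child (node t₀ t₁ t₂ t₃) ω  = t₂
child (node t₀ t₁ t₂ t₃) ω² = t₃

lookup : ∀ {n} → Trie n → Vec F4 n → Bool
lookup (leaf b) []      = b
lookup t        (x ∷ v) = lookup (child t x) v

tabulate : ∀ {n} → (Vec F4 n → Bool) → Trie n
tabulate {zero}  f = leaf (f [])
tabulate {suc n} f = node (tabulate (f ∘ (𝟎 ∷_))) (tabulate (f ∘ (𝟏 ∷_)))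
                          (tabulate (f ∘ (ω ∷_))) (tabulate (f ∘ (ω² ∷_)))

lookup-tabulate : ∀ {n} (f : Vec F4 n → Bool) v → lookup (tabulate f) v ≡ f v
lookup-tabulate f []       = refl
lookup-tabulate f (𝟎  ∷ v) = lookup-tabulate (f ∘ (𝟎 ∷_)) v
lookup-tabulate f (𝟏  ∷ v) = lookup-tabulate (f ∘ (𝟏 ∷_)) v
lookup-tabulate f (ω  ∷ v) = lookup-tabulate (f ∘ (ω ∷_)) v
lookup-tabulate f (ω² ∷ v) = lookup-tabulate (f ∘ (ω² ∷_)) v

infix 4 _∈ₜ_
_∈ₜ_ : ∀ {n} → Vec F4 n → Trie n → Set
v ∈ₜ t = T (lookup t v)

⟦_⟧ : ∀ {n} {P : Vec F4 n → Set} → Decidable P → Trie n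
⟦ P? ⟧ = tabulate (does ∘ P?)

∈⟦⟧⇔ : ∀ {n} {P : Vec F4 n → Set} (P? : Decidable P) {v} → v ∈ₜ ⟦ P? ⟧ ⇔ P v
∈⟦⟧⇔ P? {v} rewrite lookup-tabulate (does ∘ P?) v with P? v
... | yes′ p = mk⇔ (λ _ → p) (λ _ → tt)
... | no′ ¬p = mk⇔ (λ ()) ¬p

-- Enumeration of F4ⁿ without repetition

F4s : List F4
F4s = 𝟎 ∷ 𝟏 ∷ ω ∷ ω² ∷ []

∈F4s : ∀ x → x ∈ F4s
∈F4s 𝟎  = here refl
∈F4s 𝟏  = there (here refl)
∈F4s ω  = there (there (here refl))
∈F4s ω² = there (there (there (here refl)))

words : ∀ n → List (Vec F4 n)
words zero    = [] ∷ []
words (suc n) = cartesianProductWith _∷_ F4s (words n)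

∈words : ∀ {n} (v : Vec F4 n) → v ∈ words n
∈words []      = here refl
∈words (x ∷ v) = ∈-cartesianProductWith⁺ _∷_ (∈F4s x) (∈words v)

F4s-unique : Unique F4s
F4s-unique = ((λ ()) ∷ (λ ()) ∷ (λ ()) ∷ []) ∷ ((λ ()) ∷ (λ ()) ∷ []) ∷ ((λ ()) ∷ []) ∷ [] ∷ []

words-unique : ∀ n → Unique (words n)
words-unique zero    = [] ∷ []
words-unique (suc n) = cartesianProductWith⁺ _∷_ ∷-injective F4s-unique (words-unique n)

-- Counting

module _ {A : Set} where

  CountIs-resp : {P Q : A → Set} → (∀ {x} → P x ⇔ Q x) → ∀ {xs k} → CountIs P xs k → CountIs Q xs k
  CountIs-resp eq []       = []
  CountIs-resp eq (yes p c) = yes (to eq p) (CountIs-resp eq c)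
  CountIs-resp eq (no ¬p c) = no (¬p ∘ from eq) (CountIs-resp eq c)

  CountIs-map : {B : Set} {f : B → A} {P : A → Set} → ∀ {xs k} →
                CountIs (P ∘ f) xs k → CountIs P (map f xs) k
  CountIs-map []        = []
  CountIs-map (yes p c) = yes p (CountIs-map c)
  CountIs-map (no ¬p c) = no ¬p (CountIs-map c)

  CountIs-++ : {P : A → Set} → ∀ {xs ys k l} →
               CountIs P xs k → CountIs P ys l → CountIs P (xs ++ ys) (k + l)
  CountIs-++ []        d = d
  CountIs-++ (yes p c) d = yes p (CountIs-++ c d)
  CountIs-++ (no ¬p c) d = no ¬p (CountIs-++ c d)

-- The final `+ 0` matches the empty list that ends the product over `F4s`, so counts over
-- `words (suc n)` have this form on the nose.
∑ : (F4 → ℕ) → ℕ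
∑ h = h 𝟎 + (h 𝟏 + (h ω + (h ω² + 0)))

-- Translation by a nonzero `a` permutes F4 as two disjoint swaps, so only the order of the summands
-- changes.
∑-translate : ∀ a h → ∑ (h ∘ (a ⊕_)) ≡ ∑ h
∑-translate 𝟎  h = refl
∑-translate 𝟏  h = solve 4 (λ p q r s → q :+ (p :+ (s :+ (r :+ con 0))) := p :+ (q :+ (r :+ (s :+ con 0))))
                     refl (h 𝟎) (h 𝟏) (h ω) (h ω²)
  where open +-*-Solver
∑-translate ω  h = solve 4 (λ p q r s → r :+ (s :+ (p :+ (q :+ con 0))) := p :+ (q :+ (r :+ (s :+ con 0))))
                     refl (h 𝟎) (h 𝟏) (h ω) (h ω²)
  where open +-*-Solver
∑-translate ω² h = solve 4 (λ p q r s → s :+ (r :+ (q :+ (p :+ con 0))) := p :+ (q :+ (r :+ (s :+ con 0))))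
                     refl (h 𝟎) (h 𝟏) (h ω) (h ω²)
  where open +-*-Solver

-- The number of `z` in `s` with `z ⊞ d` in `t`, that is, the convolution of the two indicator
-- functions at `d`, computed one coordinate at a time.
pairCount : ∀ {n} → Trie n → Trie n → Vec F4 n → ℕ
pairCount (leaf true) (leaf true) [] = 1
pairCount (leaf _)    (leaf _)    [] = 0
pairCount s           t           (d ∷ ds) = ∑ λ x → pairCount (child s x) (child t (x ⊕ d)) ds

CountIs-words : ∀ {n} {P : Vec F4 (suc n) → Set} {h : F4 → ℕ} →
                (∀ x → CountIs (P ∘ (x ∷_)) (words n) (h x)) → CountIs P (words (suc n)) (∑ h)
CountIs-words c =
  CountIs-++ (CountIs-map (c 𝟎)) (CountIs-++ (CountIs-map (c 𝟏))
    (CountIs-++ (CountIs-map (c ω)) (CountIs-++ (CountIs-map (c ω²)) [])))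

⊕-cancel-middle : ∀ x y z → (x ⊕ y) ⊕ (x ⊕ z) ≡ y ⊕ z
⊕-cancel-middle = toWitness {a? = all? λ x → all? λ y → all? λ z → (x ⊕ y) ⊕ (x ⊕ z) ≟ y ⊕ z} _

-- Substituting y = a + z turns z + b into y + (a + b), so the count depends only on a + b. The
-- substitution is made in each coordinate by `∑-translate`.
CountIs-pairs : ∀ {n} (s t : Trie n) a b →
                CountIs (λ z → a ⊞ z ∈ₜ s × z ⊞ b ∈ₜ t) (words n) (pairCount s t (a ⊞ b))
CountIs-pairs (leaf true)  (leaf true)  [] [] = yes (tt , tt) []
CountIs-pairs (leaf true)  (leaf false) [] [] = no proj₂ []
CountIs-pairs (leaf false) (leaf _)     [] [] = no proj₁ []
CountIs-pairs s@(node _ _ _ _) t@(node _ _ _ _) (a ∷ as) (b ∷ bs) =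
  subst (CountIs _ (words _)) (∑-translate a h) (CountIs-words λ x →
    subst (λ y → CountIs (λ z → as ⊞ z ∈ₜ child s (a ⊕ x) × z ⊞ bs ∈ₜ child t (x ⊕ b)) (words _)
                         (pairCount (child s (a ⊕ x)) (child t y) (as ⊞ bs)))
      (sym (⊕-cancel-middle a x b))
      (CountIs-pairs (child s (a ⊕ x)) (child t (x ⊕ b)) as bs))
  where h = λ x → pairCount (child s x) (child t (x ⊕ (a ⊕ b))) (as ⊞ bs)

-- The distance-2 set

infix 4 _≟ᵥ_
_≟ᵥ_ : ∀ {n} → DecidableEquality (Vec F4 n)
_≟ᵥ_ = ≡-dec _≟_

open import Data.List.Membership.DecPropositional (_≟ᵥ_ {5}) using (_∈?_)

-- The connection set is supplied in two forms: the list `xs` to run through and the trie `t` for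
-- fast membership tests.
distantFrom? : ∀ {n} xs (t : Trie n) → Decidable λ d → ¬ d ≡ 𝟘 × ¬ d ∈ₜ t × Any (λ a → d ⊞ a ∈ₜ t) xs
distantFrom? xs t d =
  ¬? (d ≟ᵥ 𝟘) ×-dec ¬? (T? (lookup t d)) ×-dec Any.any? (λ a → T? (lookup t (d ⊞ a))) xs

distantTrie : ∀ {n} → List (Vec F4 n) → Trie n → Trie n
distantTrie xs t = ⟦ distantFrom? xs t ⟧

∈distantTrie⇔ : ∀ {n} {xs : List (Vec F4 n)} (∈xs? : Decidable (_∈ xs)) d →
  d ∈ₜ distantTrie xs ⟦ ∈xs? ⟧ ⇔ Distant xs d
∈distantTrie⇔ {xs = xs} ∈xs? d = mk⇔
  (λ d∈ → let d≢𝟘 , d∉ , via = to far⇔ d∈ in d≢𝟘 , d∉ ∘ from near⇔ , Any.map (to near⇔) via)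
  (λ (d≢𝟘 , d∉ , via) → from far⇔ (d≢𝟘 , d∉ ∘ to near⇔ , Any.map (from near⇔) via))
  where
  near⇔ : ∀ {v} → v ∈ₜ ⟦ ∈xs? ⟧ ⇔ v ∈ xs
  near⇔ = ∈⟦⟧⇔ ∈xs?
  far⇔ = ∈⟦⟧⇔ (distantFrom? xs ⟦ ∈xs? ⟧) {d}

expected : Trie 5 → Vec F4 5 → ℕ
expected t d = if does (d ≟ᵥ 𝟘) then 495 else if lookup t d then 238 else 240

-- Abstracting over the trie makes the evaluation of S₂ shared between all d.
expected? : ∀ t → Dec (All (λ d → pairCount t t d ≡ expected t d) (words 5))
expected? t = All.all? (λ d → pairCount t t d ℕ.≟ expected t d) (words 5)

expected-∈ : ∀ t {d} → ¬ d ≡ 𝟘 → d ∈ₜ t → expected t d ≡ 238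
expected-∈ t {d} d≢𝟘 d∈ with d ≟ᵥ 𝟘
... | yes′ d≡𝟘 = contradiction d≡𝟘 d≢𝟘
... | no′ _ with lookup t d
...   | true = refl

expected-∉ : ∀ t {d} → ¬ d ≡ 𝟘 → ¬ d ∈ₜ t → expected t d ≡ 240
expected-∉ t {d} d≢𝟘 d∉ with d ≟ᵥ 𝟘
... | yes′ d≡𝟘 = contradiction d≡𝟘 d≢𝟘
... | no′ _ with lookup t d
...   | true  = contradiction _ d∉
...   | false = refl

-- Coset representatives

reps : List Word
reps = map pad (words 5)

SameCoset-pad⇒≡ : ∀ s t → SameCoset (pad s) (pad t) → s ≡ t
SameCoset-pad⇒≡ s t same =
  ⊞≡𝟘⇒≡ (trans (sym (cong₂ _⊞_ (syn-pad s) (syn-pad t))) (to (SameCoset⇔ (pad s) (pad t)) same))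

-- `pad` is a section of `syn`: the coset of `w` is met at `pad (syn w)`, and distinct syndromes lie
-- in distinct cosets.
map-pad-transversal : ∀ {ws} → (∀ s → s ∈ ws) → Unique ws → IsTransversal SameCoset (map pad ws)
map-pad-transversal all∈ unique =
    (λ w → lose (∈-map⁺ pad (all∈ (syn w))) (SameCoset-pad-syn w))
  , AllPairs.map⁺ (AllPairs.map (λ {s} {t} s≢t → s≢t ∘ SameCoset-pad⇒≡ s t) unique)

reps-transversal : IsTransversal SameCoset reps
reps-transversal = map-pad-transversal {words 5} ∈words (words-unique 5)

-- Pair counts of the distance-2 set

opaque

  S₂ : Trie 5
  S₂ = distantTrie S₁ ⟦ _∈? S₁ ⟧

  ∈S₂⇔ : ∀ d → d ∈ₜ S₂ ⇔ Distant S₁ d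
  ∈S₂⇔ = ∈distantTrie⇔ (_∈? S₁)

opaque
  unfolding S₁ S₂

  pairCount-S₂ : ∀ d → pairCount S₂ S₂ d ≡ expected S₂ d
  -- The evaluation of all 1024 pair counts happens here, which is why `S₁` and `S₂` are unfolded.
  pairCount-S₂ d = All.lookup (toWitness {a? = expected? S₂} _) (∈words d)

-- Strong regularity of the distance-2 graph

Dist2⇔∈S₂ : ∀ x y → Dist2 x y ⇔ syn x ⊞ syn y ∈ₜ S₂
Dist2⇔∈S₂ x y = mk⇔ (from (∈S₂⇔ _) ∘ to (Dist2⇔ x y)) (from (Dist2⇔ x y) ∘ to (∈S₂⇔ _))

-- The representative `pad s` has syndrome `s`, so common neighbours of `x` and `y` correspond to
-- pairs in `S₂` with difference `syn x ⊞ syn y`.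
Dist2-paths : ∀ x y → CountIs (λ z → Dist2 x z × Dist2 z y) reps (expected S₂ (syn x ⊞ syn y))
Dist2-paths x y = subst (CountIs _ reps) (pairCount-S₂ (syn x ⊞ syn y))
  (CountIs-map {xs = words 5} (CountIs-resp (λ {s} → path⇔ s) (CountIs-pairs S₂ S₂ (syn x) (syn y))))
  where
  path⇔ : ∀ s → (syn x ⊞ s ∈ₜ S₂ × s ⊞ syn y ∈ₜ S₂) ⇔ (Dist2 x (pad s) × Dist2 (pad s) y)
  path⇔ s = mk⇔
    (λ (p , q) → from (Dist2⇔∈S₂ x (pad s)) (subst (λ v → syn x ⊞ v ∈ₜ S₂) (sym (syn-pad s)) p)
               , from (Dist2⇔∈S₂ (pad s) y) (subst (λ v → v ⊞ syn y ∈ₜ S₂) (sym (syn-pad s)) q))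
    (λ (p , q) → subst (λ v → syn x ⊞ v ∈ₜ S₂) (syn-pad s) (to (Dist2⇔∈S₂ x (pad s)) p)
               , subst (λ v → v ⊞ syn y ∈ₜ S₂) (syn-pad s) (to (Dist2⇔∈S₂ (pad s) y) q))

Dist2-sym : ∀ x y → Dist2 x y → Dist2 y x
Dist2-sym x y = from (Dist2⇔∈S₂ y x) ∘ subst (_∈ₜ S₂) (⊞-comm (syn x) (syn y)) ∘ to (Dist2⇔∈S₂ x y)

-- By symmetry the neighbours of `x` are the midpoints of the two-step walks from `x` back to `x`,
-- so the degree is the pair count at zero.
Dist2-degree : ∀ x → CountIs (Dist2 x) reps 495
Dist2-degree x = CountIs-resp (λ {z} → mk⇔ proj₁ (λ p → p , Dist2-sym x z p))
  (subst (CountIs _ reps) (cong (expected S₂) (⊞-self (syn x))) (Dist2-paths x x))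

theorem10 : StronglyRegular SameCoset Dist2 1024 495 238 240
-- The `refl` evaluates the length of `reps` to 1024.
theorem10 = reps , reps-transversal , refl , Dist2-degree
  , (λ x y xRy → subst (CountIs _ reps)
      -- Being at distance 2 includes lying in different cosets, which excludes the value 495 at
      -- zero.
      (expected-∈ S₂ (proj₁ xRy ∘ from (SameCoset⇔ x y)) (to (Dist2⇔∈S₂ x y) xRy)) (Dist2-paths x y))
  , (λ x y x≉y ¬xRy → subst (CountIs _ reps)
      (expected-∉ S₂ (x≉y ∘ from (SameCoset⇔ x y)) (¬xRy ∘ from (Dist2⇔∈S₂ x y))) (Dist2-paths x y))
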